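{- For every $r\ge2$ there is a bijection between the set of partitions of the highest root $\tilde\alpha_{B_r}=\varepsilon_1+\varepsilon_2$ of type $B_r$ into positive roots of $B_r$ and the set $\mathrm{JS}(\langle1,1\rangle,\langle1,1\rangle,r)$. In particular $K_{B_r}(\tilde\alpha_{B_r})=\mathsf{js}(\langle1,1\rangle,\langle1,1\rangle,r)$.
   Context: The positive roots of type $B_r$ are $\Phi^+_{B_r}=\{\varepsilon_i-\varepsilon_j,\ \varepsilon_i+\varepsilon_j:1\le i<j\le r\}\cup\{\varepsilon_i:1\le i\le r\}\subset\mathbb{R}^r$; a partition of $\mu$ is a finite multiset of positive roots summing to $\mu$, and $K_{B_r}(\mu)$ is the number of them. A juggling state is a finitely supported integer vector $\langle s_1,s_2,\dots\rangle$ indexed by heights (trailing zeros omitted). A juggling sequence of length $n$ from $\mathbf{a}$ to $\mathbf{b}$ is a sequence $(\mathbf{s}_0,\dots,\mathbf{s}_n)$ with $\mathbf{s}_0=\mathbf{a}$, $\mathbf{s}_n=\mathbf{b}$ such that for each $i$ there are nonnegative integers $c^{(i)}_k$ (finitely many nonzero) with $\sum_k c^{(i)}_k=(\mathbf{s}_{i-1})_1$ and $(\mathbf{s}_i)_k=(\mathbf{s}_{i-1})_{k+1}+c^{(i)}_k$ for all $k\ge1$. $\mathrm{JS}(\mathbf{a},\mathbf{b},n)$ is the set of these and $\mathsf{js}$ its cardinality. -}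

module Defs where

open import Data.Bool.Base using (if_then_else_)
open import Data.Fin.Base using (Fin; zero; suc; inject₁; fromℕ) renaming (_<_ to _<ᶠ_)
open import Data.Fin.Properties using () renaming (_≟_ to _≟ᶠ_)
open import Data.Integer.Base using (ℤ; +_; 0ℤ; 1ℤ) renaming (_+_ to _+ᶻ_; _-_ to _-ᶻ_)
open import Data.List.Base using (List; []; _∷_; foldr; map; applyUpTo; length)
open import Data.List.Relation.Binary.Permutation.Propositional using (↭-setoid)
open import Data.Nat.Base using (ℕ; zero; suc; _≤_; z≤n; s≤s)
open import Data.Nat.ListAction using (sum)
open import Data.Vec.Functional using (Vector; zipWith; replicate)
open import Function.Bundles using (Bijection)
open import Level using (Level; 0ℓ; _⊔_)
open import Relation.Binary.Bundles using (Setoid)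
open import Relation.Binary.PropositionalEquality using (_≡_; _≗_; refl; setoid; _→-setoid_)
import Relation.Binary.Construct.On as On
open import Relation.Nullary.Decidable using (⌊_⌋)

HasCardinality : ∀ {c ℓ : Level} → Setoid c ℓ → ℕ → Set (c ⊔ ℓ)
HasCardinality S n = Bijection (setoid (Fin n)) S

-- All roots of type B have integer coordinates, so the ambient ℝʳ is
-- replaced by ℤʳ; vectors are compared coordinatewise (_≗_).

infixl 6 _⊕_ _⊖_

_⊕_ _⊖_ : ∀ {r : ℕ} → Vector ℤ r → Vector ℤ r → Vector ℤ r
_⊕_ = zipWith _+ᶻ_
_⊖_ = zipWith _-ᶻ_

ε : ∀ {r : ℕ} → Fin r → Vector ℤ r
ε i j = if ⌊ i ≟ᶠ j ⌋ then 1ℤ else 0ℤ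

-- The parametrisation of the positive roots is injective (see ⟦_⟧): the
-- inequality proofs are irrelevant, and distinct indices give distinct
-- vectors.  Hence _≡_ on PositiveRoot is equality of roots.

data PositiveRoot (r : ℕ) : Set where
  εᵢ-εⱼ : (i j : Fin r) → .(i <ᶠ j) → PositiveRoot r
  εᵢ+εⱼ : (i j : Fin r) → .(i <ᶠ j) → PositiveRoot r
  εᵢ    : (i : Fin r) → PositiveRoot r

⟦_⟧ : ∀ {r : ℕ} → PositiveRoot r → Vector ℤ r
⟦ εᵢ-εⱼ i j _ ⟧ = ε i ⊖ ε j
⟦ εᵢ+εⱼ i j _ ⟧ = ε i ⊕ ε j
⟦ εᵢ i ⟧        = ε i

total : ∀ {r : ℕ} → List (PositiveRoot r) → Vector ℤ r
total {r} βs = foldr _⊕_ (replicate r 0ℤ) (map ⟦_⟧ βs)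

record Partition {r : ℕ} (μ : Vector ℤ r) : Set where
  field
    parts : List (PositiveRoot r)
    sums  : total parts ≗ μ

-- Partitions are multisets: lists of roots up to permutation.

Partitions : ∀ {r : ℕ} → Vector ℤ r → Setoid 0ℓ 0ℓ
Partitions {r} μ = On.setoid (↭-setoid {A = PositiveRoot r}) (Partition.parts {μ = μ})

highestRoot : ∀ {r : ℕ} → 2 ≤ r → Vector ℤ r
highestRoot (s≤s (s≤s _)) = ε zero ⊕ ε (suc zero)

-- Position k of a sequence (k : ℕ) stands for height k + 1.

record State : Set where
  field
    at     : ℕ → ℤ
    bound  : ℕ
    finite : ∀ (k : ℕ) → bound ≤ k → at k ≡ 0ℤ

-- The chosen bound is not part of the state's identity.

stateSetoid : Setoid 0ℓ 0ℓ
stateSetoid = On.setoid (ℕ →-setoid ℤ) State.at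

open Setoid stateSetoid using () renaming (_≈_ to _≈ˢ_) public

⟨_⟩ : List ℤ → State
⟨ xs ⟩ = record { at = entry xs ; bound = length xs ; finite = vanishes xs }
  where
  entry : List ℤ → ℕ → ℤ
  entry []       _       = 0ℤ
  entry (x ∷ _)  zero    = x
  entry (_ ∷ xs) (suc k) = entry xs k

  vanishes : ∀ (xs : List ℤ) (k : ℕ) → length xs ≤ k → entry xs k ≡ 0ℤ
  vanishes []       k       _         = refl
  vanishes (_ ∷ xs) (suc k) (s≤s len) = vanishes xs k len

record Throw (s t : State) : Set where
  private
    module s = State s
    module t = State t
  field
    c      : ℕ → ℕ
    bound  : ℕ
    finite : ∀ (k : ℕ) → bound ≤ k → c k ≡ 0
    thrown : + sum (applyUpTo c bound) ≡ s.at 0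
    lands  : ∀ (k : ℕ) → t.at k ≡ s.at (suc k) +ᶻ + c k

record JugglingSequence (a b : State) (n : ℕ) : Set where
  field
    state  : Fin (suc n) → State
    start  : state zero ≈ˢ a
    end    : state (fromℕ n) ≈ˢ b
    throws : ∀ (i : Fin n) → Throw (state (inject₁ i)) (state (suc i))

-- A juggling sequence is the sequence of its states; the numbers c are
-- only required to exist.

JS : State → State → ℕ → Setoid 0ℓ 0ℓ
JS a b n = record
  { Carrier       = JugglingSequence a b n
  ; _≈_           = λ p q → ∀ (i : Fin (suc n)) → state p i ≈ˢ state q i
  ; isEquivalence = record
    { refl  = λ {p} i → S.refl {state p i}
    ; sym   = λ {p} {q} eq i → S.sym {state p i} {state q i} (eq i)
    ; trans = λ {p} {q} {u} eq eq′ i →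
        S.trans {state p i} {state q i} {state u i} (eq i) (eq′ i)
    }
  }
  where
  open JugglingSequence using (state)
  module S = Setoid stateSetoid

-- The numbers K(μ) and js(a, b, n) are given by their graphs; a setoid
-- has at most one cardinality.

IsK : ∀ {r : ℕ} → Vector ℤ r → ℕ → Set
IsK μ k = HasCardinality (Partitions μ) k

IsJs : State → State → ℕ → ℕ → Set
IsJs a b n k = HasCardinality (JS a b n) k

{-# OPTIONS --safe #-}

-- A partition of ε₁ + ε₂ consists of roots εᵢ - εⱼ, read as arcs i → j on the
-- vertices 1, …, r, together with either two short roots εₚ, ε_q or one long
-- root εₚ + ε_q, since the sum of the coordinates is 2.  The short roots give an
-- unordered pair p ≤ q and the long root a pair of distinct indices, so both cases
-- together amount to an ordered pair (p , q).  The arcs carry one unit of flow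
-- from each of the vertices 1 and 2 to p and q.  On the other side, the throws of a
-- juggling sequence are arcs from times ≤ r to times ≤ r + 2, balanced at each
-- time ≤ r; the final state ⟨1,1⟩ says that exactly one arc ends at r + 1 and
-- exactly one at r + 2, and their starting points form the same ordered pair.
-- Finiteness holds because a positive functional bounds the number of parts.

module Submission where

open import Defs
open import Data.Empty using (⊥-elim; ⊥-elim-irr)
open import Data.Fin.Base as Fin using (Fin; zero; suc; toℕ; fromℕ; fromℕ<; inject₁)
open import Data.Fin.Induction using (<-weakInduction)
import Data.Fin.Properties as Fin
open import Data.Integer.Base as ℤ using (ℤ; +_; 0ℤ; 1ℤ)
import Data.Integer.Properties as ℤ
open import Data.Integer.Tactic.RingSolver using () renaming (solve-∀ to solveℤ-∀)
open import Data.List.Base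
  using (List; []; _∷_; _++_; map; mapMaybe; concat; concatMap; replicate; tabulate;
         applyUpTo; length; lookup; allFin; deduplicate; cartesianProduct; cartesianProductWith)
open import Data.List.Membership.Propositional using (_∈_)
open import Data.List.Membership.Propositional.Properties
  using (∈-allFin; ∈-++⁺ˡ; ∈-++⁺ʳ; ∈-∃++; ∈-lookup; ∈-map⁺; ∈-concatMap⁺; ∈-cartesianProduct⁺;
         ∈-cartesianProductWith⁺)
open import Data.List.Properties using (map-++; map-∘)
open import Data.List.Relation.Binary.Permutation.Propositional
  using (_↭_; ↭-refl; ↭-reflexive; ↭-sym; ↭-trans; ↭-setoid; prep; swap)
open import Data.List.Relation.Binary.Permutation.Propositional.Properties
  using (All-resp-↭; ∈-resp-↭; drop-∷; ↭-singleton-inv; ↭-length; shift; mapMaybe-↭; ++⁺ˡ)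
  renaming (map⁺ to ↭-map⁺)
open import Data.List.Relation.Unary.All as All using (All; []; _∷_; universal)
import Data.List.Relation.Unary.All.Properties as All
open import Data.List.Relation.Unary.AllPairs using (AllPairs; []; _∷_)
open import Data.List.Relation.Unary.Any as Any using (Any; here; there)
import Data.List.Relation.Unary.Any.Properties as Any
import Data.List.Relation.Unary.Unique.DecSetoid.Properties as Unique
open import Data.Maybe.Base using (Maybe; just; nothing)
open import Data.Nat.Base using (ℕ; zero; suc; _+_; _*_; _∸_; _≤_; _<_; z≤n; s≤s)
open import Data.Nat.ListAction using (sum)
open import Data.Nat.ListAction.Properties using (sum-++; sum-↭)
import Data.Nat.Properties as ℕ
open import Data.Nat.Tactic.RingSolver using (solve-∀)
open import Data.Product.Base using (_×_; _,_; proj₁; proj₂; ∃-syntax; ∃₂)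
open import Data.Product.Properties using (≡-dec)
open import Data.Product.Relation.Binary.Pointwise.NonDependent using (×-setoid)
open import Data.Vec.Functional using (Vector)
open import Function.Base using (_∘_; case_of_)
open import Function.Bundles using (Bijection)
import Function.Construct.Composition as Composition
import Function.Construct.Symmetry as Symmetry
open import Function.Properties.Bijection using (Bijection⇒Inverse)
open import Function.Properties.Inverse using (Inverse⇒Bijection)
open import Level using (0ℓ)
open import Relation.Binary.Bundles using (Setoid; DecSetoid)
import Relation.Binary.Construct.On as On
open import Relation.Binary.Definitions using (Decidable; DecidableEquality)
open import Relation.Binary.PropositionalEquality
  using (_≡_; _≢_; _≗_; refl; sym; trans; cong; cong₂; subst; subst₂; setoid; module ≡-Reasoning)
open import Relation.Nullary using (¬_; yes; no)
open import Relation.Nullary.Decidable using (map′; recompute)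

open ≡-Reasoning

-- Kronecker delta, weights of lists and finite sums

δ : ℕ → ℕ → ℕ
δ zero    zero    = 1
δ zero    (suc _) = 0
δ (suc _) zero    = 0
δ (suc i) (suc j) = δ i j

δ-refl : ∀ i → δ i i ≡ 1
δ-refl zero    = refl
δ-refl (suc i) = δ-refl i

δ-≢ : ∀ {i j} → i ≢ j → δ i j ≡ 0
δ-≢ {zero}  {zero}  i≢j = ⊥-elim (i≢j refl)
δ-≢ {zero}  {suc j} i≢j = refl
δ-≢ {suc i} {zero}  i≢j = refl
δ-≢ {suc i} {suc j} i≢j = δ-≢ (i≢j ∘ cong suc)

δ≢0⇒≡ : ∀ {i j} → δ i j ≢ 0 → i ≡ j
δ≢0⇒≡ {zero}  {zero}  _  = refl
δ≢0⇒≡ {zero}  {suc j} ≢0 = ⊥-elim (≢0 refl)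
δ≢0⇒≡ {suc i} {zero}  ≢0 = ⊥-elim (≢0 refl)
δ≢0⇒≡ {suc i} {suc j} ≢0 = cong suc (δ≢0⇒≡ ≢0)

δ-+ : ∀ m i j → δ (m + i) (m + j) ≡ δ i j
δ-+ zero    i j = refl
δ-+ (suc m) i j = δ-+ m i j

δ-sym : ∀ i j → δ i j ≡ δ j i
δ-sym zero    zero    = refl
δ-sym zero    (suc j) = refl
δ-sym (suc i) zero    = refl
δ-sym (suc i) (suc j) = δ-sym i j

δ-injective : ∀ {i j} → δ j i ≡ δ i i → j ≡ i
δ-injective {i} eq = δ≢0⇒≡ λ ≡0 → ℕ.0≢1+n (trans (sym ≡0) (trans eq (δ-refl i)))

-- Indicator of `i < t`; being a number, it can enter weights as a factor.
before : ℕ → ℕ → ℕ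
before _       zero    = 0
before zero    (suc _) = 1
before (suc i) (suc t) = before i t

before-suc : ∀ i t → before i (suc t) ≡ before i t + δ i t
before-suc zero    zero    = refl
before-suc zero    (suc t) = refl
before-suc (suc i) zero    = refl
before-suc (suc i) (suc t) = before-suc i t

before-< : ∀ {i t} → i < t → before i t ≡ 1
before-< {zero}  {suc t} _         = refl
before-< {suc i} {suc t} (s≤s i<t) = before-< i<t

weight : ∀ {A : Set} → (A → ℕ) → List A → ℕ
weight f xs = sum (map f xs)

module _ {A : Set} where

  weight-++ : ∀ (f : A → ℕ) xs ys → weight f (xs ++ ys) ≡ weight f xs + weight f ys
  weight-++ f xs ys = trans (cong sum (map-++ f xs ys)) (sum-++ (map f xs) (map f ys))

  weight-map : ∀ {B : Set} (f : A → ℕ) (g : B → A) xs → weight f (map g xs) ≡ weight (f ∘ g) xs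
  weight-map f g xs = cong sum (sym (map-∘ xs))

  weight-↭ : ∀ (f : A → ℕ) {xs ys} → xs ↭ ys → weight f xs ≡ weight f ys
  weight-↭ f p = sum-↭ (↭-map⁺ f p)

  weight-cong : ∀ {f g : A → ℕ} {xs} → All (λ x → f x ≡ g x) xs → weight f xs ≡ weight g xs
  weight-cong []         = refl
  weight-cong (eq ∷ eqs) = cong₂ _+_ eq (weight-cong eqs)

  weight-zero : ∀ {f : A → ℕ} {xs} → All (λ x → f x ≡ 0) xs → weight f xs ≡ 0
  weight-zero []         = refl
  weight-zero (eq ∷ eqs) = cong₂ _+_ eq (weight-zero eqs)

  weight≡0⇒ : ∀ (f : A → ℕ) {xs x} → weight f xs ≡ 0 → x ∈ xs → f x ≡ 0
  weight≡0⇒ f         eq (here refl)  = ℕ.m+n≡0⇒m≡0 _ eq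
  weight≡0⇒ f {x ∷ _} eq (there x∈xs) = weight≡0⇒ f (ℕ.m+n≡0⇒n≡0 (f x) eq) x∈xs

  weight-+ : ∀ (f g : A → ℕ) xs → weight (λ x → f x + g x) xs ≡ weight f xs + weight g xs
  weight-+ f g []       = refl
  weight-+ f g (x ∷ xs) = begin
    f x + g x + weight (λ x → f x + g x) xs    ≡⟨ cong (_+_ (f x + g x)) (weight-+ f g xs) ⟩
    f x + g x + (weight f xs + weight g xs)    ≡⟨ exchange (f x) (g x) _ _ ⟩
    f x + weight f xs + (g x + weight g xs)    ∎
    where
    exchange : ∀ a b c d → a + b + (c + d) ≡ a + c + (b + d)
    exchange = solve-∀

  weight-replicate : ∀ (f : A → ℕ) n x → weight f (replicate n x) ≡ n * f x
  weight-replicate f zero    x = refl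
  weight-replicate f (suc n) x = cong (_+_ (f x)) (weight-replicate f n x)

  extract : ∀ (f : A → ℕ) xs → weight f xs ≢ 0 → ∃₂ λ x ys → f x ≢ 0 × xs ↭ x ∷ ys
  extract f []       ≢0 = ⊥-elim (≢0 refl)
  extract f (x ∷ xs) ≢0 with f x ℕ.≟ 0
  ... | no fx≢0 = x , xs , fx≢0 , ↭-refl
  ... | yes fx≡0 with extract f xs (≢0 ∘ cong₂ _+_ fx≡0)
  ...   | y , ys , fy≢0 , p = y , x ∷ ys , fy≢0 , ↭-trans (prep x p) (swap x y ↭-refl)

  -- χ plays the role of the indicator function of equality on A.
  weights⇒↭ : ∀ (χ : A → A → ℕ) → (∀ x → χ x x ≢ 0) → (∀ {x y} → χ x y ≢ 0 → x ≡ y) →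
              ∀ xs ys → (∀ x → weight (χ x) xs ≡ weight (χ x) ys) → xs ↭ ys
  weights⇒↭ χ χ-refl χ-≡ []       []       _  = ↭-refl
  weights⇒↭ χ χ-refl χ-≡ []       (y ∷ ys) eq = ⊥-elim (χ-refl y (ℕ.m+n≡0⇒m≡0 _ (sym (eq y))))
  weights⇒↭ χ χ-refl χ-≡ (x ∷ xs) ys       eq
    with extract (χ x) ys (λ ≡0 → χ-refl x (ℕ.m+n≡0⇒m≡0 _ (trans (eq x) ≡0)))
  ... | z , zs , χxz , p with refl ← χ-≡ χxz =
    ↭-trans (prep x (weights⇒↭ χ χ-refl χ-≡ xs zs λ w →
      ℕ.+-cancelˡ-≡ (χ w x) _ _ (trans (eq w) (weight-↭ (χ w) p)))) (↭-sym p)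

sum-zero : ∀ (f : ℕ → ℕ) b → (∀ k → f k ≡ 0) → sum (applyUpTo f b) ≡ 0
sum-zero f zero    _  = refl
sum-zero f (suc b) eq = cong₂ _+_ (eq 0) (sum-zero (f ∘ suc) b (eq ∘ suc))

sum-cong : ∀ {f g : ℕ → ℕ} b → (∀ k → f k ≡ g k) → sum (applyUpTo f b) ≡ sum (applyUpTo g b)
sum-cong zero    _  = refl
sum-cong (suc b) eq = cong₂ _+_ (eq 0) (sum-cong b (eq ∘ suc))

-- At most the index `k` contributes. Outside the range the hypothesis makes the right side 0 too;
-- this is the form in which the finiteness of a throw is available.
sum-δ : ∀ (f : ℕ → ℕ) b k → (b ≤ k → f k ≡ 0) → sum (applyUpTo (λ j → f j * δ k j) b) ≡ f k
sum-δ f zero    k       out = sym (out z≤n)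
sum-δ f (suc b) zero    out = begin
  f 0 * 1 + sum (applyUpTo (λ j → f (suc j) * 0) b)
    ≡⟨ cong₂ _+_ (ℕ.*-identityʳ (f 0)) (sum-zero _ b (λ j → ℕ.*-zeroʳ (f (suc j)))) ⟩
  f 0 + 0  ≡⟨ ℕ.+-identityʳ (f 0) ⟩
  f 0      ∎
sum-δ f (suc b) (suc k) out = cong₂ _+_ (ℕ.*-zeroʳ (f 0)) (sum-δ (f ∘ suc) b k (out ∘ s≤s))

sum-+ : ∀ (f g : ℕ → ℕ) b →
        sum (applyUpTo (λ k → f k + g k) b) ≡ sum (applyUpTo f b) + sum (applyUpTo g b)
sum-+ f g zero    = refl
sum-+ f g (suc b) = begin
  f 0 + g 0 + sum (applyUpTo (λ k → f (suc k) + g (suc k)) b)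
    ≡⟨ cong (_+_ (f 0 + g 0)) (sum-+ (f ∘ suc) (g ∘ suc) b) ⟩
  f 0 + g 0 + (sum (applyUpTo (f ∘ suc) b) + sum (applyUpTo (g ∘ suc) b))
    ≡⟨ exchange (f 0) (g 0) _ _ ⟩
  f 0 + sum (applyUpTo (f ∘ suc) b) + (g 0 + sum (applyUpTo (g ∘ suc) b)) ∎
  where
  exchange : ∀ a b c d → a + b + (c + d) ≡ a + c + (b + d)
  exchange = solve-∀

-- Interchange of summation: a sum over throw heights can be evaluated arc by arc.
sum-weight : ∀ {A : Set} (f : ℕ → A → ℕ) b xs →
             sum (applyUpTo (λ k → weight (f k) xs) b) ≡ weight (λ x → sum (applyUpTo (λ k → f k x) b)) xs
sum-weight f b []       = sum-zero _ b (λ _ → refl)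
sum-weight f b (x ∷ xs) = trans (sum-+ (λ k → f k x) _ b) (cong (_+_ _) (sum-weight f b xs))

weight-concat-applyUpTo : ∀ {A : Set} (f : A → ℕ) (n : ℕ → ℕ) (x : ℕ → A) b →
  weight f (concat (applyUpTo (λ k → replicate (n k) (x k)) b)) ≡ sum (applyUpTo (λ k → n k * f (x k)) b)
weight-concat-applyUpTo f n x zero    = refl
weight-concat-applyUpTo f n x (suc b) = trans
  (weight-++ f (replicate (n 0) (x 0)) _)
  (cong₂ _+_ (weight-replicate f (n 0) (x 0)) (weight-concat-applyUpTo f (n ∘ suc) (x ∘ suc) b))

weight-concat-tabulate-zero : ∀ {A : Set} (f : A → ℕ) {n} (g : Fin n → List A) →
  (∀ i → weight f (g i) ≡ 0) → weight f (concat (tabulate g)) ≡ 0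
weight-concat-tabulate-zero f {zero}  g _  = refl
weight-concat-tabulate-zero f {suc n} g eq = trans (weight-++ f (g zero) _)
  (cong₂ _+_ (eq zero) (weight-concat-tabulate-zero f (g ∘ suc) (eq ∘ suc)))

weight-concat-tabulate : ∀ {A : Set} (f : A → ℕ) {n} (g : Fin n → List A) t →
  (∀ i → i ≢ t → weight f (g i) ≡ 0) → weight f (concat (tabulate g)) ≡ weight f (g t)
weight-concat-tabulate f g zero    eq = trans (weight-++ f (g zero) _) (trans
  (cong (_+_ (weight f (g zero))) (weight-concat-tabulate-zero f (g ∘ suc) (λ i → eq (suc i) λ ())))
  (ℕ.+-identityʳ _))
weight-concat-tabulate f g (suc t) eq = trans (weight-++ f (g zero) _) (cong₂ _+_
  (eq zero λ ())
  (weight-concat-tabulate f (g ∘ suc) t λ i i≢t → eq (suc i) λ { refl → i≢t refl }))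

-- Arcs and the juggling condition

Arc : Set
Arc = ℕ × ℕ

leaving entering : ℕ → Arc → ℕ
leaving  t (i , j) = δ i t
entering v (i , j) = δ j v

along : ℕ → ℕ → Arc → ℕ
along t v (i , j) = δ i t * δ j v

-- Selects the balls thrown strictly before time `t` that land at time `v`: those the state at time
-- `t` must record, besides the initial ones.
landed : ℕ → ℕ → Arc → ℕ
landed t v (i , j) = before i t * δ j v

weight-landed-suc : ∀ t v as → weight (landed (suc t) v) as ≡ weight (landed t v) as + weight (along t v) as
weight-landed-suc t v as = trans
  (weight-cong (universal (λ (i , j) → trans
    (cong (_* δ j v) (before-suc i t)) (ℕ.*-distribʳ-+ (δ j v) (before i t) (δ i t))) as))
  (weight-+ (landed t v) (along t v) as)

-- A forward arc ending at `t` starts before `t`, so the factor `before i t` is 1 whenever the other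
-- factor is nonzero.
landed-self : ∀ {t i j} → i < j → landed t t (i , j) ≡ entering t (i , j)
landed-self {t} {i} {j} i<j with j ℕ.≟ t
... | yes refl = trans (cong (_* δ t t) (before-< i<j)) (ℕ.*-identityˡ _)
... | no  j≢t  = trans (cong (before i t *_) (δ-≢ j≢t)) (trans (ℕ.*-zeroʳ (before i t)) (sym (δ-≢ j≢t)))

landed-after : ∀ {t i} j v → i < t → landed t v (i , j) ≡ entering v (i , j)
landed-after j v i<t = trans (cong (_* δ j v) (before-< i<t)) (ℕ.*-identityˡ _)

-- A forward arc leaving `t` ends at `suc t + k` for exactly one `k`, and `j < b` keeps that `k`
-- within the range.
sum-along : ∀ {i j b} t → i < j → j < b →
            sum (applyUpTo (λ k → along t (suc t + k) (i , j)) b) ≡ leaving t (i , j)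
sum-along {i} {j} {b} t i<j j<b with i ℕ.≟ t
... | no  i≢t  = trans (sum-zero _ b λ k → cong (_* δ j (suc t + k)) (δ-≢ i≢t)) (sym (δ-≢ i≢t))
... | yes refl with d , refl ← ℕ.m≤n⇒∃[o]m+o≡n i<j = trans
  (sum-cong b λ k → cong (δ i i *_) (δ-+ (suc i) d k))
  (sum-δ (λ _ → δ i i) b d λ b≤d →
    ⊥-elim (ℕ.<⇒≱ j<b (ℕ.≤-trans b≤d (ℕ.m≤n+m d (suc i)))))

-- One unit at each of the first two positions: both the entries of `⟨1,1⟩` and the coordinates of
-- the highest root.
pair : ℕ → ℕ
pair k = δ 0 k + δ 1 k

pair-vanishes : ∀ {k} → 2 ≤ k → pair k ≡ 0
pair-vanishes (s≤s (s≤s _)) = refl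

⟨1,1⟩ : State
⟨1,1⟩ = ⟨ 1ℤ ∷ 1ℤ ∷ [] ⟩

at-⟨1,1⟩ : ∀ k → State.at ⟨1,1⟩ k ≡ + pair k
at-⟨1,1⟩ zero          = refl
at-⟨1,1⟩ (suc zero)    = refl
at-⟨1,1⟩ (suc (suc k)) = refl

-- The arc (i , j) stands for a ball thrown at time i so as to land at time j;
-- times are counted from 0.
record IsJuggling (r : ℕ) (as : List Arc) : Set where
  field
    forward  : All (λ (i , j) → i < j × i < r × j < 2 + r) as
    balanced : ∀ {t} → t < r → weight (leaving t) as ≡ pair t + weight (entering t) as
    caught   : ∀ h → weight (entering (r + h)) as ≡ pair h

-- Closed form for the states: position `k` at time `t` holds the balls due at time `t + k`, either
-- initial ones or ones thrown earlier.
height : List Arc → ℕ → ℕ → ℕ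
height as t k = pair (t + k) + weight (landed t (t + k)) as

-- Both positions refer to the landing time `suc t + k`; passing to the next time adds only the arcs
-- thrown at `t`. This is the rule `lands` of a throw.
height-suc : ∀ as t k → height as (suc t) k ≡ height as t (suc k) + weight (along t (suc t + k)) as
height-suc as t k = begin
  pair v + weight (landed (suc t) v) as
    ≡⟨ cong (_+_ (pair v)) (weight-landed-suc t v as) ⟩
  pair v + (weight (landed t v) as + weight (along t v) as)
    ≡⟨ ℕ.+-assoc (pair v) _ _ ⟨
  pair v + weight (landed t v) as + weight (along t v) as
    ≡⟨ cong (λ u → pair u + weight (landed t u) as + weight (along t v) as) (ℕ.+-suc t k) ⟨
  height as t (suc k) + weight (along t v) as ∎
  where v = suc t + k

-- From arcs to juggling sequences

module _ {r : ℕ} (2≤r : 2 ≤ r) {as : List Arc} (isJuggling : IsJuggling r as) where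
  open IsJuggling isJuggling

  private
    far : ∀ {v} (f : Arc → ℕ) → (∀ {i j} → j ≢ v → f (i , j) ≡ 0) → 2 + r ≤ v → weight f as ≡ 0
    far f f≡0 v≥ = weight-zero (All.map (λ (_ , _ , j<) → f≡0 (ℕ.<⇒≢ (ℕ.<-≤-trans j< v≥))) forward)

  stateAt : ℕ → State
  stateAt t = record
    { at     = λ k → + height as t k
    -- All arcs land before time `2 + r` and the initial balls before time 2, so one bound serves
    -- every `t`.
    ; bound  = 2 + r
    ; finite = λ k k≥ → let v≥ = ℕ.≤-trans k≥ (ℕ.m≤n+m k t) in cong +_ (cong₂ _+_
        (pair-vanishes (ℕ.≤-trans (ℕ.m≤m+n 2 r) v≥))
        (far (landed t (t + k)) (λ {i} j≢v →
          trans (cong (before i t *_) (δ-≢ j≢v)) (ℕ.*-zeroʳ (before i t))) v≥))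
    }

  throwAt : ∀ {t} → t < r → Throw (stateAt t) (stateAt (suc t))
  throwAt {t} t<r = record
    { c      = λ k → weight (along t (suc t + k)) as
    ; bound  = 2 + r
    ; finite = λ k k≥ → far (along t (suc t + k)) (λ {i} j≢v →
        trans (cong (δ i t *_) (δ-≢ j≢v)) (ℕ.*-zeroʳ (δ i t))) (ℕ.≤-trans k≥ (ℕ.m≤n+m k (suc t)))
    ; thrown = cong +_ thrown
    ; lands  = λ k → cong +_ (height-suc as t k)
    }
    where
    -- Summing over the heights counts the arcs leaving `t`. Balance turns these into the initial
    -- ball due at `t`, if any, and the arcs entering `t`, which together form the lowest entry of
    -- the state.
    thrown : sum (applyUpTo (λ k → weight (along t (suc t + k)) as) (2 + r)) ≡ height as t 0
    thrown = begin
      sum (applyUpTo (λ k → weight (along t (suc t + k)) as) (2 + r))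
        ≡⟨ sum-weight (λ k → along t (suc t + k)) (2 + r) as ⟩
      weight (λ a → sum (applyUpTo (λ k → along t (suc t + k) a) (2 + r))) as
        ≡⟨ weight-cong (All.map (λ (i<j , _ , j<) → sum-along t i<j j<) forward) ⟩
      weight (leaving t) as
        ≡⟨ balanced t<r ⟩
      pair t + weight (entering t) as
        ≡⟨ cong (_+_ (pair t)) (weight-cong (All.map (λ (i<j , _) → landed-self i<j) forward)) ⟨
      pair t + weight (landed t t) as
        ≡⟨ cong (λ v → pair v + weight (landed t v) as) (ℕ.+-identityʳ t) ⟨
      height as t 0 ∎

  juggle : JugglingSequence ⟨1,1⟩ ⟨1,1⟩ r
  juggle = record
    { state  = λ i → stateAt (toℕ i)
    ; start  = λ k → trans
        (cong +_ (trans (cong (_+_ (pair k)) (weight-zero (universal (λ _ → refl) as))) (ℕ.+-identityʳ (pair k))))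
        (sym (at-⟨1,1⟩ k))
    ; end    = λ k → trans
        (cong (λ t → + height as t k) (Fin.toℕ-fromℕ r))
        (trans (cong +_ (end k)) (sym (at-⟨1,1⟩ k)))
    ; throws = λ i → subst (λ t → Throw (stateAt t) (stateAt (suc (toℕ i))))
        (sym (Fin.toℕ-inject₁ i)) (throwAt (Fin.toℕ<n i))
    }
    where
    -- By time `r` the initial balls have landed, because `2 ≤ r`, and every arc has been thrown, so
    -- the state counts all arcs ending at `r + k`.
    end : ∀ k → height as r k ≡ pair k
    end k = trans
      (cong₂ _+_ (pair-vanishes (ℕ.≤-trans 2≤r (ℕ.m≤m+n r k)))
        (weight-cong (All.map (λ {(_ , j)} (_ , i<r , _) → landed-after j (r + k) i<r) forward)))
      (caught k)

-- From juggling sequences to arcs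

module _ {r : ℕ} (2≤r : 2 ≤ r) (js : JugglingSequence ⟨1,1⟩ ⟨1,1⟩ r) where
  open JugglingSequence js
  private module T i = Throw (throws i)

  -- Position `k` stands for height `k + 1`, so a ball thrown there at time `i` lands at time
  -- `i + k + 1`.
  block : Fin r → List Arc
  block i = concat (applyUpTo (λ k → replicate (T.c i k) (toℕ i , suc (toℕ i + k))) (T.bound i))

  arcs : List Arc
  arcs = concat (tabulate block)

  weight-block : ∀ f i →
    weight f (block i) ≡ sum (applyUpTo (λ k → T.c i k * f (toℕ i , suc (toℕ i + k))) (T.bound i))
  weight-block f i = weight-concat-applyUpTo f (T.c i) _ (T.bound i)

  -- Distinct blocks have distinct starting times, so a weight that vanishes off `t` sees a single
  -- block.
  weight-arcs : ∀ (f : Arc → ℕ) t → (∀ {i j} → i ≢ toℕ t → f (i , j) ≡ 0) →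
    weight f arcs ≡ sum (applyUpTo (λ k → T.c t k * f (toℕ t , suc (toℕ t + k))) (T.bound t))
  weight-arcs f t f≡0 = trans
    (weight-concat-tabulate f block t λ i i≢t → trans (weight-block f i)
      (sum-zero _ (T.bound i) λ k →
        trans (cong (T.c i k *_) (f≡0 (i≢t ∘ Fin.toℕ-injective))) (ℕ.*-zeroʳ (T.c i k))))
    (weight-block f t)

  along-arcs : ∀ t k → weight (along (toℕ t) (suc (toℕ t) + k)) arcs ≡ T.c t k
  along-arcs t k = begin
    weight (along (toℕ t) (suc (toℕ t) + k)) arcs
      ≡⟨ weight-arcs _ t (λ {_} {j} i≢t → cong (_* δ j (suc (toℕ t) + k)) (δ-≢ i≢t)) ⟩
    sum (applyUpTo (λ l → T.c t l * (δ (toℕ t) (toℕ t) * δ (toℕ t + l) (toℕ t + k))) (T.bound t))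
      ≡⟨ sum-cong (T.bound t) (λ l → cong (T.c t l *_) (trans
           (cong₂ _*_ (δ-refl (toℕ t)) (trans (δ-+ (toℕ t) l k) (δ-sym l k))) (ℕ.*-identityˡ _))) ⟩
    sum (applyUpTo (λ l → T.c t l * δ k l) (T.bound t))
      ≡⟨ sum-δ (T.c t) (T.bound t) k (T.finite t k) ⟩
    T.c t k ∎

  leaving-arcs : ∀ t → weight (leaving (toℕ t)) arcs ≡ sum (applyUpTo (T.c t) (T.bound t))
  leaving-arcs t = trans (weight-arcs _ t δ-≢) (sum-cong (T.bound t) λ k →
    trans (cong (T.c t k *_) (δ-refl (toℕ t))) (ℕ.*-identityʳ (T.c t k)))

  forward-arcs : All (λ (i , j) → i < j × i < r) arcs
  forward-arcs = All.concat⁺ (All.tabulate⁺ λ i → All.concat⁺ (All.applyUpTo⁺₂ _ (T.bound i) λ k →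
    All.replicate⁺ (T.c i k) (s≤s (ℕ.m≤m+n (toℕ i) k) , Fin.toℕ<n i)))

  -- Induction on time: the states start from `⟨1,1⟩` and obey the recursion of `height-suc`, with
  -- the numbers `c` recovered by `along-arcs`. The states are thus determined by the arcs.
  state-arcs : ∀ i k → State.at (state i) k ≡ + height arcs (toℕ i) k
  state-arcs = <-weakInduction _ base step
    where
    base : ∀ k → State.at (state zero) k ≡ + height arcs 0 k
    base k = trans (start k) (trans (at-⟨1,1⟩ k) (cong +_ (sym (trans
      (cong (_+_ (pair k)) (weight-zero (universal (λ _ → refl) arcs))) (ℕ.+-identityʳ (pair k))))))

    step : ∀ i → (∀ k → State.at (state (inject₁ i)) k ≡ + height arcs (toℕ (inject₁ i)) k) →
           ∀ k → State.at (state (suc i)) k ≡ + height arcs (suc (toℕ i)) k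
    step i ih k = begin
      State.at (state (suc i)) k
        ≡⟨ T.lands i k ⟩
      State.at (state (inject₁ i)) (suc k) ℤ.+ + T.c i k
        ≡⟨ cong₂ (λ x y → x ℤ.+ + y) (ih (suc k)) (sym (along-arcs i k)) ⟩
      + (height arcs (toℕ (inject₁ i)) (suc k) + weight (along (toℕ i) (suc (toℕ i) + k)) arcs)
        ≡⟨ cong (λ t → + (height arcs t (suc k) + weight (along (toℕ i) (suc (toℕ i) + k)) arcs)) (Fin.toℕ-inject₁ i) ⟩
      + (height arcs (toℕ i) (suc k) + weight (along (toℕ i) (suc (toℕ i) + k)) arcs)
        ≡⟨ cong +_ (height-suc arcs (toℕ i) k) ⟨
      + height arcs (suc (toℕ i)) k ∎

  -- At the final time every arc has been thrown, so the prescribed final state counts the arcs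
  -- ending at `r + h`.
  caught-arcs : ∀ h → weight (entering (r + h)) arcs ≡ pair h
  caught-arcs h = ℤ.+-injective (begin
    + weight (entering (r + h)) arcs
      ≡⟨ cong +_ (weight-cong (All.map (λ {(_ , j)} (_ , i<r) → landed-after j (r + h) i<r) forward-arcs)) ⟨
    + weight (landed r (r + h)) arcs
      ≡⟨ cong (λ n → + (n + weight (landed r (r + h)) arcs)) (pair-vanishes (ℕ.≤-trans 2≤r (ℕ.m≤m+n r h))) ⟨
    + height arcs r h
      ≡⟨ cong (λ t → + height arcs t h) (Fin.toℕ-fromℕ r) ⟨
    + height arcs (toℕ (fromℕ r)) h
      ≡⟨ state-arcs (fromℕ r) h ⟨
    State.at (state (fromℕ r)) h
      ≡⟨ end h ⟩
    State.at ⟨1,1⟩ h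
      ≡⟨ at-⟨1,1⟩ h ⟩
    + pair h ∎)

  -- The condition `thrown`, with the lowest entry of the state rewritten by `state-arcs`.
  balanced-arcs : ∀ t → weight (leaving (toℕ t)) arcs ≡ pair (toℕ t) + weight (entering (toℕ t)) arcs
  balanced-arcs t = ℤ.+-injective (begin
    + weight (leaving (toℕ t)) arcs
      ≡⟨ cong +_ (leaving-arcs t) ⟩
    + sum (applyUpTo (T.c t) (T.bound t))
      ≡⟨ T.thrown t ⟩
    State.at (state (inject₁ t)) 0
      ≡⟨ state-arcs (inject₁ t) 0 ⟩
    + height arcs (toℕ (inject₁ t)) 0
      ≡⟨ cong (λ u → + height arcs u 0) (Fin.toℕ-inject₁ t) ⟩
    + height arcs (toℕ t) 0
      ≡⟨ cong (λ v → + (pair v + weight (landed (toℕ t) v) arcs)) (ℕ.+-identityʳ (toℕ t)) ⟩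
    + (pair (toℕ t) + weight (landed (toℕ t) (toℕ t)) arcs)
      ≡⟨ cong (λ n → + (pair (toℕ t) + n)) (weight-cong (All.map (λ (i<j , _) → landed-self i<j) forward-arcs)) ⟩
    + (pair (toℕ t) + weight (entering (toℕ t)) arcs) ∎)

-- Juggling sequences as flows

record Edge (r : ℕ) : Set where
  constructor edge
  field
    source target  : Fin r
    .source<target : toℕ source < toℕ target

arc : ∀ {r} → Edge r → Arc
arc (edge i j _) = toℕ i , toℕ j

arc-< : ∀ {r} (e : Edge r) → proj₁ (arc e) < proj₂ (arc e)
arc-< (edge i j i<j) = recompute (_ ℕ.<? _) i<j

edge-≡ : ∀ {r} {d e : Edge r} → arc d ≡ arc e → d ≡ e
edge-≡ {d = edge i j _} {e = edge i′ j′ _} eq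
  with refl ← Fin.toℕ-injective (cong proj₁ eq) | refl ← Fin.toℕ-injective (cong proj₂ eq) = refl

edges : ∀ {r} (as : List Arc) → All (λ (i , j) → i < j × i < r × j < r) as →
        ∃[ es ] map (arc {r}) es ≡ as
edges []             []                       = [] , refl
edges ((i , j) ∷ as) ((i<j , i<r , j<r) ∷ ok) with edges as ok
... | es , refl = edge (fromℕ< i<r) (fromℕ< j<r) <′ ∷ es , cong (_∷ _) (cong₂ _,_ (Fin.toℕ-fromℕ< i<r) (Fin.toℕ-fromℕ< j<r))
  where
  <′ : toℕ (fromℕ< i<r) < toℕ (fromℕ< j<r)
  <′ rewrite Fin.toℕ-fromℕ< i<r | Fin.toℕ-fromℕ< j<r = i<j

-- With times counted from 0, the final state occurs at time `r` and its two balls are due at `r`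
-- and `r + 1`; the two exits end there.
flowArcs : ∀ {r} → List (Edge r) → Fin r → Fin r → List Arc
flowArcs {r} es p q = (toℕ p , r) ∷ (toℕ q , suc r) ∷ map arc es

-- The common model of both sides. The exits are ordered because they end at different times;
-- `Flows` ignores the order of the inner edges and the proof of balance.
record Flow (r : ℕ) : Set where
  constructor flow
  field
    inner    : List (Edge r)
    exit₁    : Fin r
    exit₂    : Fin r
    balanced : ∀ (k : Fin r) → weight (leaving (toℕ k)) (flowArcs {r} inner exit₁ exit₂)
                     ≡ pair (toℕ k) + weight (entering (toℕ k)) (flowArcs inner exit₁ exit₂)

  allArcs : List Arc
  allArcs = flowArcs inner exit₁ exit₂

Flows : ℕ → Setoid 0ℓ 0ℓ
Flows r = On.setoid (×-setoid (↭-setoid {A = Edge r}) (setoid (Fin r × Fin r)))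
  (λ f → Flow.inner f , Flow.exit₁ f , Flow.exit₂ f)

weight-edges-zero : ∀ {r} (f : Arc → ℕ) (es : List (Edge r)) →
                    (∀ {i j} → j < r → f (i , j) ≡ 0) → weight f (map arc es) ≡ 0
weight-edges-zero f es f≡0 = weight-zero (All.map⁺ (universal (λ e → f≡0 {proj₁ (arc e)} (Fin.toℕ<n (Edge.target e))) es))

entering-exits : ∀ r h p q → weight (entering (r + h)) ((p , r) ∷ (q , suc r) ∷ []) ≡ pair h
entering-exits r h p q = trans (cong (_+_ (δ r (r + h))) (ℕ.+-identityʳ _)) (cong₂ _+_
  (trans (cong (λ m → δ m (r + h)) (sym (ℕ.+-identityʳ r))) (δ-+ r 0 h))
  (trans (cong (λ m → δ m (r + h)) (sym (ℕ.+-comm r 1))) (δ-+ r 1 h)))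

flow-isJuggling : ∀ {r} (f : Flow r) → IsJuggling r (Flow.allArcs f)
flow-isJuggling {r} (flow es p q balanced) = record
  { forward  = (Fin.toℕ<n p , Fin.toℕ<n p , ℕ.m≤n+m (suc r) 1)
             ∷ (ℕ.m≤n⇒m≤1+n (Fin.toℕ<n q) , Fin.toℕ<n q , ℕ.≤-refl)
             ∷ All.map⁺ (universal (λ e → arc-< e , Fin.toℕ<n (Edge.source e) ,
                 ℕ.≤-trans (Fin.toℕ<n (Edge.target e)) (ℕ.m≤n+m r 2)) es)
  ; balanced = λ t<r → subst (λ t → weight (leaving t) (flowArcs es p q) ≡ pair t + weight (entering t) (flowArcs es p q))
                 (Fin.toℕ-fromℕ< t<r) (balanced (fromℕ< t<r))
  ; caught   = λ h → trans
      (weight-++ (entering (r + h)) ((toℕ p , r) ∷ (toℕ q , suc r) ∷ []) (map arc es))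
      (trans (cong₂ _+_ (entering-exits r h (toℕ p) (toℕ q))
        (weight-edges-zero (entering (r + h)) es λ j<r → δ-≢ (ℕ.<⇒≢ (ℕ.<-≤-trans j<r (ℕ.m≤m+n r h)))))
        (ℕ.+-identityʳ (pair h)))
  }

module _ {r} (es : List (Edge r)) (p q : Fin r) where

  private
    δ-suc : ∀ n → δ n (suc n) ≡ 0
    δ-suc n = δ-≢ (ℕ.<⇒≢ (ℕ.n<1+n n))

    along-inner-zero : ∀ {t v} → r ≤ v → weight (along t v) (map arc es) ≡ 0
    along-inner-zero {t} {v} r≤v = weight-edges-zero (along t v) es λ {i} j<r →
      trans (cong (δ i t *_) (δ-≢ (ℕ.<⇒≢ (ℕ.<-≤-trans j<r r≤v)))) (ℕ.*-zeroʳ (δ i t))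

    along-≢ : ∀ {t v i j} → j ≢ v → along t v (i , j) ≡ 0
    along-≢ {t} {v} {i} j≢v = trans (cong (δ i t *_) (δ-≢ j≢v)) (ℕ.*-zeroʳ (δ i t))

    along-self : ∀ t v i → along t v (i , v) ≡ δ i t
    along-self t v i = trans (cong (δ i t *_) (δ-refl v)) (ℕ.*-identityʳ (δ i t))

  along-exit₁ : ∀ t → weight (along t r) (flowArcs es p q) ≡ δ (toℕ p) t
  along-exit₁ t = trans
    (cong₂ _+_ (along-self t r (toℕ p)) (cong₂ _+_ (along-≢ {t} {r} {toℕ q} ℕ.1+n≢n) (along-inner-zero {t} ℕ.≤-refl)))
    (ℕ.+-identityʳ _)

  along-exit₂ : ∀ t → weight (along t (suc r)) (flowArcs es p q) ≡ δ (toℕ q) t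
  along-exit₂ t = trans
    (cong₂ _+_ (along-≢ {t} {suc r} {toℕ p} (ℕ.1+n≢n ∘ sym))
      (cong₂ _+_ (along-self t (suc r) (toℕ q)) (along-inner-zero {t} (ℕ.n≤1+n r))))
    (ℕ.+-identityʳ _)

  along-inner : ∀ {t v} → v < r → weight (along t v) (flowArcs es p q) ≡ weight (λ e → along t v (arc e)) es
  along-inner {t} {v} v<r =
    cong₂ _+_ (along-≢ {t} {v} {toℕ p} (ℕ.<⇒≢ v<r ∘ sym))
      (cong₂ _+_ (along-≢ {t} {v} {toℕ q} (ℕ.<⇒≢ (ℕ.m≤n⇒m≤1+n v<r) ∘ sym))
        (weight-map (along t v) arc es))

-- The bijection between flows and juggling sequences

module _ {r : ℕ} (2≤r : 2 ≤ r) where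

  toJS : Flow r → JugglingSequence ⟨1,1⟩ ⟨1,1⟩ r
  toJS f = juggle 2≤r (flow-isJuggling f)

  toJS-cong : ∀ {f g} → Setoid._≈_ (Flows r) f g → Setoid._≈_ (JS ⟨1,1⟩ ⟨1,1⟩ r) (toJS f) (toJS g)
  toJS-cong {flow es p q _} {flow es′ .p .q _} (es↭es′ , refl) i k = cong (λ n → + (pair (toℕ i + k) + n))
    (weight-↭ (landed (toℕ i) (toℕ i + k)) (prep (toℕ p , r) (prep (toℕ q , suc r) (↭-map⁺ arc es↭es′))))

  -- By `height-suc`, two consecutive states determine how many arcs are thrown from `t` to each
  -- later time.
  toJS-along : ∀ {f g} → Setoid._≈_ (JS ⟨1,1⟩ ⟨1,1⟩ r) (toJS f) (toJS g) →
    ∀ (t : Fin r) {v} → toℕ t < v → weight (along (toℕ t) v) (Flow.allArcs f) ≡ weight (along (toℕ t) v) (Flow.allArcs g)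
  toJS-along {f} {g} eq t t<v with k , refl ← ℕ.m≤n⇒∃[o]m+o≡n t<v =
    ℕ.+-cancelˡ-≡ (height F (toℕ t) (suc k)) _ _ (begin
      height F (toℕ t) (suc k) + weight (along (toℕ t) (suc (toℕ t) + k)) F
        ≡⟨ height-suc F (toℕ t) k ⟨
      height F (suc (toℕ t)) k
        ≡⟨ ℤ.+-injective (eq (suc t) k) ⟩
      height G (suc (toℕ t)) k
        ≡⟨ height-suc G (toℕ t) k ⟩
      height G (toℕ t) (suc k) + weight (along (toℕ t) (suc (toℕ t) + k)) G
        ≡⟨ cong (_+ weight (along (toℕ t) (suc (toℕ t) + k)) G) same ⟨
      height F (toℕ t) (suc k) + weight (along (toℕ t) (suc (toℕ t) + k)) G ∎)
    where
    F = Flow.allArcs f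
    G = Flow.allArcs g
    same : height F (toℕ t) (suc k) ≡ height G (toℕ t) (suc k)
    same = subst (λ u → height F u (suc k) ≡ height G u (suc k)) (Fin.toℕ-inject₁ t)
      (ℤ.+-injective (eq (inject₁ t) (suc k)))

  -- The arc counts determine a flow: the ends `r` and `r + 1` give the exits, the ends below `r`
  -- the inner edges.
  toJS-injective : ∀ {f g} → Setoid._≈_ (JS ⟨1,1⟩ ⟨1,1⟩ r) (toJS f) (toJS g) → Setoid._≈_ (Flows r) f g
  toJS-injective {f@(flow es p q _)} {g@(flow es′ p′ q′ _)} eq = inner , cong₂ _,_ p≡p′ q≡q′
    where
    p≡p′ : p ≡ p′
    p≡p′ = sym (Fin.toℕ-injective (δ-injective (trans (sym (along-exit₁ es′ p′ q′ (toℕ p)))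
      (trans (sym (toJS-along {f} {g} eq p (Fin.toℕ<n p))) (along-exit₁ es p q (toℕ p))))))

    q≡q′ : q ≡ q′
    q≡q′ = sym (Fin.toℕ-injective (δ-injective (trans (sym (along-exit₂ es′ p′ q′ (toℕ q)))
      (trans (sym (toJS-along {f} {g} eq q (ℕ.m≤n⇒m≤1+n (Fin.toℕ<n q)))) (along-exit₂ es p q (toℕ q))))))

    -- Nonzero only when both endpoints agree, so it is an indicator for `weights⇒↭`, and its
    -- weights are the arc counts compared by `toJS-along`.
    χ : Edge r → Edge r → ℕ
    χ d e = along (proj₁ (arc d)) (proj₂ (arc d)) (arc e)

    χ-refl : ∀ d → χ d d ≢ 0
    χ-refl d ≡0 = ℕ.1+n≢0 (trans (sym (cong₂ _*_ (δ-refl (proj₁ (arc d))) (δ-refl (proj₂ (arc d))))) ≡0)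

    χ-≡ : ∀ {d e} → χ d e ≢ 0 → d ≡ e
    χ-≡ {d} {e} ≢0 = sym (edge-≡ (cong₂ _,_
      (δ≢0⇒≡ λ ≡0 → ≢0 (cong (_* δ (proj₂ (arc e)) (proj₂ (arc d))) ≡0))
      (δ≢0⇒≡ λ ≡0 → ≢0 (trans (cong (δ (proj₁ (arc e)) (proj₁ (arc d)) *_) ≡0)
        (ℕ.*-zeroʳ (δ (proj₁ (arc e)) (proj₁ (arc d))))))))

    inner : es ↭ es′
    inner = weights⇒↭ χ χ-refl χ-≡ es es′ λ d →
      let d<r = Fin.toℕ<n (Edge.target d) in
      trans (sym (along-inner es p q d<r)) (trans (toJS-along {f} {g} eq (Edge.source d) (arc-< d))
        (along-inner es′ p′ q′ d<r))

  -- The cases `h = 0` and `h = 1` each provide an arc, which is then moved to the front.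
  split-exits : ∀ as → (∀ h → weight (entering (r + h)) as ≡ pair h) →
                ∃[ i ] ∃[ k ] ∃[ bs ] as ↭ (i , r) ∷ (k , suc r) ∷ bs
  split-exits as caught
    with extract (entering (r + 0)) as (λ ≡0 → ℕ.1+n≢0 (trans (sym (caught 0)) ≡0))
  ... | (i , j) , bs , j≢ , as↭
    with refl ← trans (δ≢0⇒≡ {j} j≢) (ℕ.+-identityʳ r)
    -- The arc already removed ends at `r`, so the one ending at `r + 1` is still in `bs`.
    with extract (entering (r + 1)) bs (λ ≡0 → ℕ.1+n≢0 (trans (sym (caught 1))
           (trans (weight-↭ (entering (r + 1)) as↭)
             (cong₂ _+_ (δ-≢ {r} {r + 1} λ eq → ℕ.1+n≢n (trans (sym (ℕ.+-comm r 1)) (sym eq))) ≡0))))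
  ... | (k , l) , cs , l≢ , bs↭
    with refl ← trans (δ≢0⇒≡ {l} l≢) (ℕ.+-comm r 1) = i , k , cs , ↭-trans as↭ (prep _ bs↭)

  -- The two exits already account for all arcs ending at `r` or later, so the remaining ones end
  -- below `r` and are edges.
  decompose : ∀ as → All (λ (i , j) → i < j × i < r) as → (∀ h → weight (entering (r + h)) as ≡ pair h) →
              ∃[ es ] ∃[ p ] ∃[ q ] as ↭ flowArcs {r} es p q
  decompose as forward caught
    with i , k , bs , as↭ ← split-exits as caught
    with (_ , i<r) ∷ (_ , k<r) ∷ ok ← All-resp-↭ as↭ forward
    = let es , eq = edges bs (All.zipWith (λ ((i<j , i<r) , j<r) → i<j , i<r , j<r) (ok , All.tabulate (below _)))
      in es , fromℕ< i<r , fromℕ< k<r , ↭-trans as↭ (↭-reflexive (cong₂ _∷_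
           (cong (_, r) (sym (Fin.toℕ-fromℕ< i<r)))
           (cong₂ _∷_ (cong (_, suc r) (sym (Fin.toℕ-fromℕ< k<r))) (sym eq))))
    where
    bs-zero : ∀ h → weight (entering (r + h)) bs ≡ 0
    bs-zero h = ℕ.+-cancelˡ-≡ (pair h) _ _ (begin
      pair h + weight (entering (r + h)) bs
        ≡⟨ cong (_+ weight (entering (r + h)) bs) (entering-exits r h i k) ⟨
      weight (entering (r + h)) ((i , r) ∷ (k , suc r) ∷ []) + weight (entering (r + h)) bs
        ≡⟨ weight-++ (entering (r + h)) ((i , r) ∷ (k , suc r) ∷ []) bs ⟨
      weight (entering (r + h)) ((i , r) ∷ (k , suc r) ∷ bs)
        ≡⟨ weight-↭ (entering (r + h)) as↭ ⟨
      weight (entering (r + h)) as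
        ≡⟨ caught h ⟩
      pair h
        ≡⟨ ℕ.+-identityʳ (pair h) ⟨
      pair h + 0 ∎)

    below : ∀ a → a ∈ bs → proj₂ a < r
    below (_ , j) a∈bs = ℕ.≰⇒> λ r≤j → case ℕ.m≤n⇒∃[o]m+o≡n r≤j of λ where
      (h , refl) → ℕ.1+n≢0 (trans (sym (δ-refl j)) (weight≡0⇒ (entering j) (bs-zero h) a∈bs))

  -- Heights and balance depend on the arcs only up to permutation, so both pass from the arcs of
  -- `js` to their decomposition.
  toJS-surjective : ∀ js → ∃[ f ] Setoid._≈_ (JS ⟨1,1⟩ ⟨1,1⟩ r) (toJS f) js
  toJS-surjective js with decompose (arcs 2≤r js) (forward-arcs 2≤r js) (caught-arcs 2≤r js)
  ... | es , p , q , as↭ = flow es p q balanced , λ i k → sym (trans (state-arcs 2≤r js i k)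
          (cong (λ n → + (pair (toℕ i + k) + n)) (weight-↭ (landed (toℕ i) (toℕ i + k)) as↭)))
    where
    balanced : ∀ k → weight (leaving (toℕ k)) (flowArcs es p q)
                     ≡ pair (toℕ k) + weight (entering (toℕ k)) (flowArcs es p q)
    balanced k = trans (sym (weight-↭ (leaving (toℕ k)) as↭)) (trans (balanced-arcs 2≤r js k)
      (cong (_+_ (pair (toℕ k))) (weight-↭ (entering (toℕ k)) as↭)))

  Flows⤖JS : Bijection (Flows r) (JS ⟨1,1⟩ ⟨1,1⟩ r)
  Flows⤖JS = record
    { to        = toJS
    ; cong      = λ {f} {g} → toJS-cong {f} {g}
    ; bijective = (λ {f} {g} → toJS-injective {f} {g}) , λ js → let f , eq = toJS-surjective js in
        f , λ {g} g≈f → Setoid.trans (JS ⟨1,1⟩ ⟨1,1⟩ r) {toJS g} {toJS f} {js} (toJS-cong {g} {f} g≈f) eq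
    }

-- Partitions as flows

ε-δ : ∀ {r} (i j : Fin r) → ε i j ≡ + δ (toℕ i) (toℕ j)
ε-δ i j with i Fin.≟ j
... | yes refl = cong +_ (sym (δ-refl (toℕ i)))
... | no  i≢j  = cong +_ (sym (δ-≢ (i≢j ∘ Fin.toℕ-injective)))

ε-suc : ∀ {r} (i j : Fin r) → ε (suc i) (suc j) ≡ ε i j
ε-suc i j = trans (ε-δ (suc i) (suc j)) (sym (ε-δ i j))

-- The positive and negative parts of a root, kept as natural numbers so that coordinate equations
-- become balance conditions.
outflow inflow : ∀ {r} → ℕ → PositiveRoot r → ℕ
outflow k (εᵢ-εⱼ i j _) = δ (toℕ i) k
outflow k (εᵢ+εⱼ i j _) = δ (toℕ i) k + δ (toℕ j) k
outflow k (εᵢ i)        = δ (toℕ i) k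
inflow k (εᵢ-εⱼ i j _) = δ (toℕ j) k
inflow k (εᵢ+εⱼ i j _) = 0
inflow k (εᵢ i)        = 0

root-flow : ∀ {r} (β : PositiveRoot r) k → ⟦ β ⟧ k ≡ + outflow (toℕ k) β ℤ.- + inflow (toℕ k) β
root-flow (εᵢ-εⱼ i j _) k = cong₂ ℤ._-_ (ε-δ i k) (ε-δ j k)
root-flow (εᵢ+εⱼ i j _) k = trans (cong₂ ℤ._+_ (ε-δ i k) (ε-δ j k)) (sym (ℤ.+-identityʳ _))
root-flow (εᵢ i)        k = trans (ε-δ i k) (sym (ℤ.+-identityʳ _))

total-flow : ∀ {r} (βs : List (PositiveRoot r)) k →
             total βs k ≡ + weight (outflow (toℕ k)) βs ℤ.- + weight (inflow (toℕ k)) βs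
total-flow []       k = refl
total-flow (β ∷ βs) k = trans (cong₂ ℤ._+_ (root-flow β k) (total-flow βs k))
  (exchange (+ outflow (toℕ k) β) (+ inflow (toℕ k) β)
    (+ weight (outflow (toℕ k)) βs) (+ weight (inflow (toℕ k)) βs))
  where
  exchange : ∀ a b c d → a ℤ.- b ℤ.+ (c ℤ.- d) ≡ a ℤ.+ c ℤ.- (b ℤ.+ d)
  exchange = solveℤ-∀

difference⇒balance : ∀ {a b m} → + a ℤ.- + b ≡ + m → a ≡ m + b
difference⇒balance {a} {b} {m} eq = ℤ.+-injective (trans (restore (+ a) (+ b)) (cong (ℤ._+ + b) eq))
  where
  restore : ∀ x y → x ≡ x ℤ.- y ℤ.+ y
  restore = solveℤ-∀

balance⇒difference : ∀ {a b m} → a ≡ m + b → + a ℤ.- + b ≡ + m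
balance⇒difference {b = b} {m} refl = cancel (+ m) (+ b)
  where
  cancel : ∀ x y → x ℤ.+ y ℤ.- y ≡ x
  cancel = solveℤ-∀

highestRoot-pair : ∀ {r} (2≤r : 2 ≤ r) k → highestRoot 2≤r k ≡ + pair (toℕ k)
highestRoot-pair (s≤s (s≤s _)) k = cong₂ ℤ._+_ (ε-δ zero k) (ε-δ (suc zero) k)

inner : ∀ {r} → Edge r → PositiveRoot r
inner (edge i j i<j) = εᵢ-εⱼ i j i<j

-- An ordered pair of exits is a pair of short roots or a long root,
-- according to its order.
exits : ∀ {r} → Fin r → Fin r → List (PositiveRoot r)
exits p q with p Fin.≤? q
... | yes _  = εᵢ p ∷ εᵢ q ∷ []
... | no p≰q = εᵢ+εⱼ q p (ℕ.≰⇒> p≰q) ∷ []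

exits-≤ : ∀ {r} {p q : Fin r} → p Fin.≤ q → exits p q ≡ εᵢ p ∷ εᵢ q ∷ []
exits-≤ {p = p} {q} p≤q with p Fin.≤? q
... | yes _  = refl
... | no p≰q = ⊥-elim (p≰q p≤q)

exits-> : ∀ {r} {p q : Fin r} .(q<p : q Fin.< p) → exits p q ≡ εᵢ+εⱼ q p q<p ∷ []
exits-> {p = p} {q} q<p with p Fin.≤? q
... | yes p≤q = ⊥-elim-irr (ℕ.<⇒≱ q<p p≤q)
... | no _    = refl

outflow-exits : ∀ {r} (p q : Fin r) k → weight (outflow k) (exits p q) ≡ δ (toℕ p) k + δ (toℕ q) k
outflow-exits p q k with p Fin.≤? q
... | yes _ = cong (_+_ (δ (toℕ p) k)) (ℕ.+-identityʳ _)
... | no _  = trans (ℕ.+-identityʳ _) (ℕ.+-comm (δ (toℕ q) k) (δ (toℕ p) k))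

inflow-exits : ∀ {r} (p q : Fin r) k → weight (inflow k) (exits p q) ≡ 0
inflow-exits p q k with p Fin.≤? q
... | yes _ = refl
... | no _  = refl

roots : ∀ {r} → List (Edge r) → Fin r → Fin r → List (PositiveRoot r)
roots es p q = exits p q ++ map inner es

outflow-roots : ∀ {r} (es : List (Edge r)) p q k →
                weight (outflow k) (roots es p q) ≡ weight (leaving k) (flowArcs es p q)
outflow-roots es p q k = begin
  weight (outflow k) (roots es p q)
    ≡⟨ weight-++ (outflow k) (exits p q) (map inner es) ⟩
  weight (outflow k) (exits p q) + weight (outflow k) (map inner es)
    ≡⟨ cong₂ _+_ (outflow-exits p q k) (trans (weight-map (outflow k) inner es) (sym (weight-map (leaving k) arc es))) ⟩
  δ (toℕ p) k + δ (toℕ q) k + weight (leaving k) (map arc es)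
    ≡⟨ ℕ.+-assoc (δ (toℕ p) k) _ _ ⟩
  weight (leaving k) (flowArcs es p q) ∎

-- The exit roots have no inflow, and the exit arcs end at `r` and `r + 1`, beyond every vertex `k`.
inflow-roots : ∀ {r} (es : List (Edge r)) p q (k : Fin r) →
               weight (inflow (toℕ k)) (roots es p q) ≡ weight (entering (toℕ k)) (flowArcs es p q)
inflow-roots {r} es p q k = begin
  weight (inflow (toℕ k)) (roots es p q)
    ≡⟨ weight-++ (inflow (toℕ k)) (exits p q) (map inner es) ⟩
  weight (inflow (toℕ k)) (exits p q) + weight (inflow (toℕ k)) (map inner es)
    ≡⟨ cong₂ _+_ (inflow-exits p q (toℕ k))
        (trans (weight-map (inflow (toℕ k)) inner es) (sym (weight-map (entering (toℕ k)) arc es))) ⟩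
  weight (entering (toℕ k)) (map arc es)
    ≡⟨ cong₂ (λ m n → m + (n + weight (entering (toℕ k)) (map arc es)))
        (δ-≢ {r} (ℕ.<⇒≢ (Fin.toℕ<n k) ∘ sym)) (δ-≢ {suc r} (ℕ.<⇒≢ (ℕ.m≤n⇒m≤1+n (Fin.toℕ<n k)) ∘ sym)) ⟨
  weight (entering (toℕ k)) (flowArcs es p q) ∎

-- Together with `exit?` this separates differences from the other roots. Filtering respects
-- permutations, so both halves of `roots` can be read off the multiset.
edge? : ∀ {r} → PositiveRoot r → Maybe (Edge r)
edge? (εᵢ-εⱼ i j i<j) = just (edge i j i<j)
edge? (εᵢ+εⱼ _ _ _)   = nothing
edge? (εᵢ _)          = nothing

exit? : ∀ {r} → PositiveRoot r → Maybe (PositiveRoot r)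
exit? (εᵢ-εⱼ _ _ _) = nothing
exit? β             = just β

edge?-inner : ∀ {r} (es : List (Edge r)) → mapMaybe edge? (map inner es) ≡ es
edge?-inner []       = refl
edge?-inner (e ∷ es) = cong (e ∷_) (edge?-inner es)

exit?-inner : ∀ {r} (es : List (Edge r)) → mapMaybe exit? (map inner es) ≡ []
exit?-inner []       = refl
exit?-inner (e ∷ es) = exit?-inner es

edge?-roots : ∀ {r} (es : List (Edge r)) p q → mapMaybe edge? (roots es p q) ≡ es
edge?-roots es p q with p Fin.≤? q
... | yes _ = edge?-inner es
... | no _  = edge?-inner es

exit?-roots : ∀ {r} (es : List (Edge r)) p q → mapMaybe exit? (roots es p q) ≡ exits p q
exit?-roots es p q with p Fin.≤? q
... | yes _ = cong (λ βs → εᵢ p ∷ εᵢ q ∷ βs) (exit?-inner es)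
... | no _  = cong (_ ∷_) (exit?-inner es)

-- The number of roots tells long from short. A long root determines its indices, and two short
-- roots are listed in increasing order.
exits-injective : ∀ {r} (p q p′ q′ : Fin r) → exits p q ↭ exits p′ q′ → (p , q) ≡ (p′ , q′)
exits-injective p q p′ q′ eq with p Fin.≤? q | p′ Fin.≤? q′
... | yes _   | no _  with () ← ↭-length eq
... | no _    | yes _ with () ← ↭-length eq
... | no _    | no _  with refl ← ↭-singleton-inv eq = refl
... | yes p≤q | yes p′≤q′ with ∈-resp-↭ eq (here refl)
...   | here refl with refl ← ↭-singleton-inv (drop-∷ eq) = refl
-- Here `p = q′` and `q = p′`, so the two inequalities are opposite and all four indices coincide.
...   | there (here refl) with refl ← ↭-singleton-inv (drop-∷ (↭-trans eq (swap _ _ ↭-refl))) =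
        cong₂ _,_ (Fin.≤-antisym p≤q p′≤q′) (Fin.≤-antisym p′≤q′ p≤q)

-- Linear functionals and the charge of a root

dot : ∀ {r} → Vector ℤ r → Vector ℤ r → ℤ
dot {zero}  w v = 0ℤ
dot {suc r} w v = w zero ℤ.* v zero ℤ.+ dot (w ∘ suc) (v ∘ suc)

dot-cong : ∀ {r} (w : Vector ℤ r) {u v} → u ≗ v → dot w u ≡ dot w v
dot-cong {zero}  w eq = refl
dot-cong {suc r} w eq = cong₂ ℤ._+_ (cong (w zero ℤ.*_) (eq zero)) (dot-cong (w ∘ suc) (eq ∘ suc))

dot-0 : ∀ {r} (w : Vector ℤ r) → dot w (λ _ → 0ℤ) ≡ 0ℤ
dot-0 {zero}  w = refl
dot-0 {suc r} w = cong₂ ℤ._+_ (ℤ.*-zeroʳ (w zero)) (dot-0 (w ∘ suc))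

dot-⊕ : ∀ {r} (w u v : Vector ℤ r) → dot w (u ⊕ v) ≡ dot w u ℤ.+ dot w v
dot-⊕ {zero}  w u v = refl
dot-⊕ {suc r} w u v = trans (cong (ℤ._+_ (w zero ℤ.* (u zero ℤ.+ v zero))) (dot-⊕ (w ∘ suc) (u ∘ suc) (v ∘ suc)))
  (expand (w zero) (u zero) (v zero) _ _)
  where
  expand : ∀ a b c x y → a ℤ.* (b ℤ.+ c) ℤ.+ (x ℤ.+ y) ≡ a ℤ.* b ℤ.+ x ℤ.+ (a ℤ.* c ℤ.+ y)
  expand = solveℤ-∀

dot-⊖ : ∀ {r} (w u v : Vector ℤ r) → dot w (u ⊖ v) ≡ dot w u ℤ.- dot w v
dot-⊖ {zero}  w u v = refl
dot-⊖ {suc r} w u v = trans (cong (ℤ._+_ (w zero ℤ.* (u zero ℤ.- v zero))) (dot-⊖ (w ∘ suc) (u ∘ suc) (v ∘ suc)))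
  (expand (w zero) (u zero) (v zero) _ _)
  where
  expand : ∀ a b c x y → a ℤ.* (b ℤ.- c) ℤ.+ (x ℤ.- y) ≡ a ℤ.* b ℤ.+ x ℤ.- (a ℤ.* c ℤ.+ y)
  expand = solveℤ-∀

dot-ε : ∀ {r} (w : Vector ℤ r) i → dot w (ε i) ≡ w i
dot-ε w zero    = trans (cong₂ ℤ._+_ (ℤ.*-identityʳ (w zero)) (dot-0 (w ∘ suc))) (ℤ.+-identityʳ (w zero))
dot-ε w (suc i) = trans (cong₂ ℤ._+_ (ℤ.*-zeroʳ (w zero))
  (trans (dot-cong (w ∘ suc) (ε-suc i)) (dot-ε (w ∘ suc) i))) (ℤ.+-identityˡ (w (suc i)))

-- Linearity turns a functional with natural values on the roots into a weight on lists. It serves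
-- twice: for the charge, and for the rank that bounds the number of parts.
dot-total : ∀ {r} (w : Vector ℤ r) (f : PositiveRoot r → ℕ) → (∀ β → dot w ⟦ β ⟧ ≡ + f β) →
            ∀ βs → dot w (total βs) ≡ + weight f βs
dot-total w f eq []       = dot-0 w
dot-total w f eq (β ∷ βs) = trans (dot-⊕ w ⟦ β ⟧ (total βs)) (cong₂ ℤ._+_ (eq β) (dot-total w f eq βs))

-- The sum of the coordinates of the root.
charge : ∀ {r} → PositiveRoot r → ℕ
charge (εᵢ-εⱼ _ _ _) = 0
charge (εᵢ+εⱼ _ _ _) = 2
charge (εᵢ _)        = 1

dot-charge : ∀ {r} (β : PositiveRoot r) → dot (λ _ → 1ℤ) ⟦ β ⟧ ≡ + charge β
dot-charge (εᵢ-εⱼ i j _) = trans (dot-⊖ _ (ε i) (ε j)) (cong₂ ℤ._-_ (dot-ε _ i) (dot-ε _ j))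
dot-charge (εᵢ+εⱼ i j _) = trans (dot-⊕ _ (ε i) (ε j)) (cong₂ ℤ._+_ (dot-ε _ i) (dot-ε _ j))
dot-charge (εᵢ i)        = dot-ε _ i

dot-highestRoot : ∀ {r} (2≤r : 2 ≤ r) → dot (λ _ → 1ℤ) (highestRoot 2≤r) ≡ + 2
dot-highestRoot {suc (suc n)} (s≤s (s≤s _)) = trans (dot-⊕ {suc (suc n)} (λ _ → 1ℤ) (ε zero) (ε (suc zero)))
  (cong₂ ℤ._+_ (dot-ε {suc (suc n)} (λ _ → 1ℤ) zero) (dot-ε {suc (suc n)} (λ _ → 1ℤ) (suc zero)))

charge-0 : ∀ {r} (βs : List (PositiveRoot r)) → weight charge βs ≡ 0 → ∃[ es ] βs ≡ map inner es
charge-0 []                     _  = [] , refl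
charge-0 (εᵢ-εⱼ i j i<j ∷ βs) eq with es , refl ← charge-0 βs eq = edge i j i<j ∷ es , refl

charge-1 : ∀ {r} (βs : List (PositiveRoot r)) → weight charge βs ≡ 1 →
           ∃[ es ] ∃[ p ] βs ↭ εᵢ p ∷ map inner es
charge-1 (εᵢ-εⱼ i j i<j ∷ βs) eq with es , p , βs↭ ← charge-1 βs eq =
  edge i j i<j ∷ es , p , ↭-trans (prep _ βs↭) (swap _ _ ↭-refl)
charge-1 (εᵢ p ∷ βs) eq with es , refl ← charge-0 βs (ℕ.suc-injective eq) = es , p , ↭-refl

-- Differences have charge 0, so besides them there is either one long root or two short ones; the
-- short ones are put in order.
charge-2 : ∀ {r} (βs : List (PositiveRoot r)) → weight charge βs ≡ 2 →
           ∃[ es ] ∃[ p ] ∃[ q ] βs ↭ roots es p q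
charge-2 (εᵢ-εⱼ i j i<j ∷ βs) eq with es , p , q , βs↭ ← charge-2 βs eq =
  edge i j i<j ∷ es , p , q , ↭-trans (prep _ βs↭) (↭-sym (shift _ (exits p q) (map inner es)))
charge-2 (εᵢ+εⱼ i j i<j ∷ βs) eq with es , refl ← charge-0 βs (ℕ.suc-injective (ℕ.suc-injective eq)) =
  -- A long root stands for decreasing exits, hence the larger index `j` comes first.
  es , j , i , ↭-reflexive (cong (_++ map inner es) (sym (exits-> i<j)))
charge-2 (εᵢ i ∷ βs) eq with es , j , βs↭ ← charge-1 βs (ℕ.suc-injective eq) | i Fin.≤? j
... | yes i≤j = es , i , j , ↭-trans (prep _ βs↭) (↭-reflexive (cong (_++ map inner es) (sym (exits-≤ i≤j))))
... | no  i≰j = es , j , i , ↭-trans (prep _ βs↭) (↭-trans (swap _ _ ↭-refl)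
      (↭-reflexive (cong (_++ map inner es) (sym (exits-≤ (ℕ.<⇒≤ (ℕ.≰⇒> i≰j)))))))

-- The bijection between flows and partitions

module _ {r : ℕ} (2≤r : 2 ≤ r) where
  private
    μ = highestRoot 2≤r

  toPartition : Flow r → Partition μ
  toPartition (flow es p q balanced) = record
    { parts = roots es p q
    ; sums  = λ k → trans (total-flow (roots es p q) k) (trans
        (balance⇒difference (trans (outflow-roots es p q (toℕ k))
          (trans (balanced k) (cong (_+_ (pair (toℕ k))) (sym (inflow-roots es p q k))))))
        (sym (highestRoot-pair 2≤r k)))
    }

  toPartition-cong : ∀ {f g} → Setoid._≈_ (Flows r) f g → Setoid._≈_ (Partitions μ) (toPartition f) (toPartition g)
  toPartition-cong {flow es p q _} {flow es′ .p .q _} (es↭es′ , refl) = ++⁺ˡ (exits p q) (↭-map⁺ inner es↭es′)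

  toPartition-injective : ∀ {f g} → Setoid._≈_ (Partitions μ) (toPartition f) (toPartition g) → Setoid._≈_ (Flows r) f g
  toPartition-injective {flow es p q _} {flow es′ p′ q′ _} eq =
    subst₂ _↭_ (edge?-roots es p q) (edge?-roots es′ p′ q′) (mapMaybe-↭ edge? eq) ,
    exits-injective p q p′ q′
      (subst₂ _↭_ (exit?-roots es p q) (exit?-roots es′ p′ q′) (mapMaybe-↭ exit? eq))

  toPartition-surjective : ∀ P → ∃[ f ] Setoid._≈_ (Partitions μ) (toPartition f) P
  toPartition-surjective P = let es , p , q , parts↭ = charge-2 parts charged in
    flow es p q (λ k → trans (sym (outflow-roots es p q (toℕ k))) (trans
      (sym (weight-↭ (outflow (toℕ k)) parts↭)) (trans (balanced k) (cong (_+_ (pair (toℕ k)))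
        (trans (weight-↭ (inflow (toℕ k)) parts↭) (inflow-roots es p q k)))))) ,
    ↭-sym parts↭
    where
    open Partition P
    charged : weight charge parts ≡ 2
    charged = ℤ.+-injective (trans (sym (dot-total _ charge dot-charge parts))
      (trans (dot-cong _ sums) (dot-highestRoot 2≤r)))

    balanced : ∀ k → weight (outflow (toℕ k)) parts ≡ pair (toℕ k) + weight (inflow (toℕ k)) parts
    balanced k = difference⇒balance (trans (sym (total-flow parts k)) (trans (sums k) (highestRoot-pair 2≤r k)))

  Flows⤖Partitions : Bijection (Flows r) (Partitions μ)
  Flows⤖Partitions = record
    { to        = toPartition
    ; cong      = λ {f} {g} → toPartition-cong {f} {g}
    ; bijective = (λ {f} {g} → toPartition-injective {f} {g}) , λ P →
        let f , eq = toPartition-surjective P in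
        f , λ {g} g≈f → ↭-trans (toPartition-cong {g} {f} g≈f) eq
    }

-- Finiteness

module _ {c ℓ} (S : Setoid c ℓ) where
  open Setoid S using (Carrier; _≈_) renaming (sym to ≈-sym; trans to ≈-trans)

  lookup-injective : ∀ {xs : List Carrier} → AllPairs (λ x y → ¬ (x ≈ y)) xs →
                     ∀ i j → lookup xs i ≈ lookup xs j → i ≡ j
  lookup-injective (_ ∷ _)      zero    zero    _  = refl
  lookup-injective (x≉xs ∷ _)   zero    (suc j) eq = ⊥-elim (All.lookup x≉xs (∈-lookup j) eq)
  lookup-injective (x≉xs ∷ _)   (suc i) zero    eq = ⊥-elim (All.lookup x≉xs (∈-lookup i) (≈-sym eq))
  lookup-injective (_ ∷ unique) (suc i) (suc j) eq = cong suc (lookup-injective unique i j eq)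

  -- Removing duplicates from a covering list leaves each class once, so positions in the list
  -- enumerate the classes.
  finite : (_≟_ : Decidable _≈_) (xs : List Carrier) → (∀ x → Any (x ≈_) xs) → ∃[ n ] HasCardinality S n
  finite _≟_ xs covers = length ys , record
    { to        = lookup ys
    ; cong      = λ { refl → Setoid.refl S }
    ; bijective = (λ {i} {j} → lookup-injective (Unique.deduplicate-! DS xs) i j) , λ x →
        Any.index (found x) , λ { refl → ≈-sym (Any.lookup-index (found x)) }
    }
    where
    DS : DecSetoid c ℓ
    DS = record { isDecEquivalence = record { isEquivalence = Setoid.isEquivalence S ; _≟_ = _≟_ } }
    ys = deduplicate _≟_ xs
    found : ∀ x → Any (x ≈_) ys
    found x = Any.deduplicate⁺ _≟_ (λ z≈y x≈y → ≈-trans x≈y (≈-sym z≈y)) (covers x)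

-- Delete one occurrence of the head from `ys` and recurse; by cancellation the choice of the
-- occurrence does not matter.
↭-dec : ∀ {A : Set} → DecidableEquality A → Decidable (_↭_ {A = A})
↭-dec _≟_ []       []       = yes ↭-refl
↭-dec _≟_ []       (y ∷ ys) = no λ p → case ↭-length p of λ ()
↭-dec _≟_ (x ∷ xs) ys with x ∈? ys
  where open import Data.List.Membership.DecPropositional _≟_ using (_∈?_)
... | no  x∉ys = no λ p → x∉ys (∈-resp-↭ p (here refl))
... | yes x∈ys with us , vs , refl ← ∈-∃++ x∈ys = map′
      (λ p → ↭-trans (prep x p) (↭-sym (shift x us vs)))
      (λ p → drop-∷ (↭-trans p (shift x us vs)))
      (↭-dec _≟_ xs (us ++ vs))

listsUpTo : ∀ {A : Set} → List A → ℕ → List (List A)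
listsUpTo as zero    = [] ∷ []
listsUpTo as (suc n) = [] ∷ cartesianProductWith _∷_ as (listsUpTo as n)

∈-listsUpTo : ∀ {A : Set} {as : List A} → (∀ a → a ∈ as) → ∀ n xs → length xs ≤ n → xs ∈ listsUpTo as n
∈-listsUpTo all zero    []       _         = here refl
∈-listsUpTo all (suc n) []       _         = here refl
∈-listsUpTo all (suc n) (x ∷ xs) (s≤s len) = there (∈-cartesianProductWith⁺ _∷_ (all x) (∈-listsUpTo all n xs len))

module _ {r : ℕ} where

  private
    code : PositiveRoot r → Fin 3 × Fin r × Fin r
    code (εᵢ-εⱼ i j _) = zero , i , j
    code (εᵢ+εⱼ i j _) = suc zero , i , j
    code (εᵢ i)        = suc (suc zero) , i , i

    code-injective : ∀ {α β} → code α ≡ code β → α ≡ β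
    code-injective {εᵢ-εⱼ _ _ _} {εᵢ-εⱼ _ _ _} refl = refl
    code-injective {εᵢ+εⱼ _ _ _} {εᵢ+εⱼ _ _ _} refl = refl
    code-injective {εᵢ _}        {εᵢ _}        refl = refl

  _≟ᴿ_ : DecidableEquality (PositiveRoot r)
  α ≟ᴿ β = map′ code-injective (cong code) (≡-dec Fin._≟_ (≡-dec Fin._≟_ Fin._≟_) (code α) (code β))

  longRoots : Fin r × Fin r → List (PositiveRoot r)
  longRoots (i , j) with i Fin.<? j
  ... | yes i<j = εᵢ-εⱼ i j i<j ∷ εᵢ+εⱼ i j i<j ∷ []
  ... | no  _   = []

  positiveRoots : List (PositiveRoot r)
  positiveRoots = map εᵢ (allFin r) ++ concatMap longRoots (cartesianProduct (allFin r) (allFin r))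

  ∈-longRoots : ∀ {i j} .(i<j : i Fin.< j) → εᵢ-εⱼ i j i<j ∈ longRoots (i , j) × εᵢ+εⱼ i j i<j ∈ longRoots (i , j)
  ∈-longRoots {i} {j} i<j with i Fin.<? j
  ... | yes _   = here refl , there (here refl)
  ... | no  i≮j = ⊥-elim-irr (i≮j i<j)

  ∈-longRoots⇒∈-positiveRoots : ∀ {β i j} → β ∈ longRoots (i , j) → β ∈ positiveRoots
  ∈-longRoots⇒∈-positiveRoots {i = i} {j} β∈ = ∈-++⁺ʳ (map εᵢ (allFin r)) (∈-concatMap⁺ longRoots
    (Any.map (λ { refl → β∈ }) (∈-cartesianProduct⁺ (∈-allFin i) (∈-allFin j))))

  ∈-positiveRoots : ∀ β → β ∈ positiveRoots
  ∈-positiveRoots (εᵢ i)          = ∈-++⁺ˡ (∈-map⁺ εᵢ (∈-allFin i))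
  ∈-positiveRoots (εᵢ-εⱼ i j i<j) = ∈-longRoots⇒∈-positiveRoots (proj₁ (∈-longRoots i<j))
  ∈-positiveRoots (εᵢ+εⱼ i j i<j) = ∈-longRoots⇒∈-positiveRoots (proj₂ (∈-longRoots i<j))

  -- The linear functional ε i ↦ r ∸ i is positive on every positive root.
  level : Fin r → ℕ
  level i = r ∸ toℕ i

  rank : PositiveRoot r → ℕ
  rank (εᵢ-εⱼ i j _) = level i ∸ level j
  rank (εᵢ+εⱼ i j _) = level i + level j
  rank (εᵢ i)        = level i

  dot-rank : ∀ β → dot (λ i → + level i) ⟦ β ⟧ ≡ + rank β
  dot-rank (εᵢ-εⱼ i j i<j) = trans (dot-⊖ _ (ε i) (ε j)) (trans (cong₂ ℤ._-_ (dot-ε _ i) (dot-ε _ j))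
    -- The truncated subtraction in `rank` is exact, since `i < j` gives `level j ≤ level i`.
    (trans (ℤ.m-n≡m⊖n (level i) (level j))
      (ℤ.⊖-≥ (ℕ.∸-monoʳ-≤ r (ℕ.<⇒≤ (recompute (toℕ i ℕ.<? toℕ j) i<j))))))
  dot-rank (εᵢ+εⱼ i j _) = trans (dot-⊕ _ (ε i) (ε j)) (cong₂ ℤ._+_ (dot-ε _ i) (dot-ε _ j))
  dot-rank (εᵢ i)        = dot-ε _ i

  level-positive : ∀ i → 1 ≤ level i
  level-positive i = ℕ.m<n⇒0<n∸m (Fin.toℕ<n i)

  rank-positive : ∀ β → 1 ≤ rank β
  rank-positive (εᵢ-εⱼ i j i<j) = ℕ.m<n⇒0<n∸m
    (ℕ.∸-monoʳ-< (recompute (toℕ i ℕ.<? toℕ j) i<j) (ℕ.<⇒≤ (Fin.toℕ<n j)))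
  rank-positive (εᵢ+εⱼ i j _) = ℕ.m≤n⇒m≤n+o (level j) (level-positive i)
  rank-positive (εᵢ i)        = level-positive i

  length≤rank : ∀ βs → length βs ≤ weight rank βs
  length≤rank []       = z≤n
  length≤rank (β ∷ βs) = ℕ.+-mono-≤ (rank-positive β) (length≤rank βs)

module _ {r : ℕ} (μ : Vector ℤ r) where

  -- The value of the level functional at `μ`. If `μ` has a partition this value is a sum of ranks,
  -- so the absolute value changes nothing.
  length-bound : ℕ
  length-bound = ℤ.∣ dot (λ i → + level i) μ ∣

  length≤bound : ∀ (P : Partition μ) → length (Partition.parts P) ≤ length-bound
  length≤bound P = subst (length parts ≤_)
    (cong ℤ.∣_∣ (trans (sym (dot-total _ rank dot-rank parts)) (dot-cong _ sums))) (length≤rank parts)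
    where open Partition P

  partitionsAmong : List (List (PositiveRoot r)) → List (Partition μ)
  partitionsAmong []         = []
  partitionsAmong (βs ∷ βss) with Fin.all? (λ k → total βs k ℤ.≟ μ k)
  ... | yes sums = record { parts = βs ; sums = sums } ∷ partitionsAmong βss
  ... | no  _    = partitionsAmong βss

  partitionsAmong-complete : ∀ (P : Partition μ) {βss} → Partition.parts P ∈ βss →
                             Any (λ Q → Partition.parts P ↭ Partition.parts Q) (partitionsAmong βss)
  partitionsAmong-complete P {βs ∷ _} P∈ with Fin.all? (λ k → total βs k ℤ.≟ μ k) | P∈
  ... | yes _    | here refl = here ↭-refl
  ... | yes _    | there P∈′ = there (partitionsAmong-complete P P∈′)
  ... | no ¬sums | here refl = ⊥-elim (¬sums (Partition.sums P))
  ... | no _     | there P∈′ = partitionsAmong-complete P P∈′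

  Partitions-finite : ∃[ n ] IsK μ n
  Partitions-finite = finite (Partitions μ) (λ P Q → ↭-dec _≟ᴿ_ (Partition.parts P) (Partition.parts Q))
    (partitionsAmong (listsUpTo positiveRoots length-bound))
    (λ P → partitionsAmong-complete P (∈-listsUpTo ∈-positiveRoots length-bound (Partition.parts P) (length≤bound P)))

mainTheorem11 : ∀ (r : ℕ) (2≤r : 2 ≤ r) →
    Bijection (Partitions (highestRoot 2≤r)) (JS ⟨ 1ℤ ∷ 1ℤ ∷ [] ⟩ ⟨ 1ℤ ∷ 1ℤ ∷ [] ⟩ r)
    × (∃[ K ] ∃[ js ]
    (IsK (highestRoot 2≤r) K × IsJs ⟨ 1ℤ ∷ 1ℤ ∷ [] ⟩ ⟨ 1ℤ ∷ 1ℤ ∷ [] ⟩ r js × K ≡ js))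
-- The count of partitions is transported along `Φ`, so the same number `K` counts the juggling
-- sequences.
mainTheorem11 r 2≤r = Φ , K , K , isK , Composition.bijection isK Φ , refl
  where
  Φ : Bijection (Partitions (highestRoot 2≤r)) (JS ⟨1,1⟩ ⟨1,1⟩ r)
  Φ = Composition.bijection
    (Inverse⇒Bijection (Symmetry.inverse (Bijection⇒Inverse (Flows⤖Partitions 2≤r))))
    (Flows⤖JS 2≤r)
  K = proj₁ (Partitions-finite (highestRoot 2≤r))
  isK = proj₂ (Partitions-finite (highestRoot 2≤r))
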